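{- The set of all $(x,y,z)\in\mathbb{N}^3$ satisfying $3\cdot 3^x+3^y=z^2$ is $$\left\{(2n,\,2n,\,2\cdot 3^n) : n\in\mathbb{N}\right\}\cup\left\{(1+2n,\,3+2n,\,2\cdot 3^{n+1}) : n\in\mathbb{N}\right\}.$$
   Context: $\mathbb{N}=\{0,1,2,3,\ldots\}$ denotes the set of non-negative integers. -}

module Defs where

module Submission where

-- By symmetry write the left-hand side as 3 ^ a * (1 + 3 ^ d) with a the smaller
-- exponent.  Dividing z by 3 lowers a by 2, so only a = 0 and a = 1 remain.
-- For a = 1, 3 would divide 1 + 3 ^ d, which is 2 or 1 modulo 3.  For a = 0,
-- 3 ^ d = (z - 1) * (z + 1); these factors are powers of 3 that differ by 2,
-- hence z - 1 = 1.

open import Data.Nat using (ℕ; _+_; _*_; _^_)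
open import Data.Product using (_×_; _,_; ∃-syntax)
open import Relation.Binary.PropositionalEquality using (_≡_)
open import Relation.Unary using (_≐_; _∪_)
open import Defs

open import Data.Nat using (zero; suc; _≤_)
open import Data.Nat.Divisibility
  using (_∣_; divides-refl; _∣?_; m∣m*n; ∣m+n∣m⇒∣n)
open import Data.Nat.Primality using (Prime; prime?; euclidsLemma)
open import Data.Nat.Properties
open import Data.Nat.Tactic.RingSolver using (solve-∀)
open import Data.Sum using (_⊎_; inj₁; inj₂; reduce)
open import Relation.Binary.PropositionalEquality
  using (refl; sym; trans; cong; cong₂; subst; module ≡-Reasoning)
open import Relation.Nullary using (¬_; contradiction)
open import Relation.Nullary.Decidable using (from-yes; from-no)

∣m+n∣n⇒∣m : ∀ {d m n} → d ∣ m + n → d ∣ n → d ∣ m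
∣m+n∣n⇒∣m {d} {m} {n} d∣m+n = ∣m+n∣m⇒∣n (subst (d ∣_) (+-comm m n) d∣m+n)

prime[3] : Prime 3
prime[3] = from-yes (prime? 3)

3∤1 : ¬ 3 ∣ 1
3∤1 = from-no (3 ∣? 1)

3∤2 : ¬ 3 ∣ 2
3∤2 = from-no (3 ∣? 2)

3∣m*m⇒3∣m : ∀ {m} → 3 ∣ m * m → 3 ∣ m
3∣m*m⇒3∣m {m} 3∣m² = reduce (euclidsLemma m m prime[3] 3∣m²)

-- Induction on `d`: by Euclid's lemma 3 divides `m` or `n`; in the second case a factor 3 is
-- cancelled from `n`, leaving `m` untouched.
m*n≡3^d⇒m≡1⊎3∣m : ∀ d m n → m * n ≡ 3 ^ d → m ≡ 1 ⊎ 3 ∣ m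
m*n≡3^d⇒m≡1⊎3∣m zero m n eq = inj₁ (m*n≡1⇒m≡1 m n eq)
m*n≡3^d⇒m≡1⊎3∣m (suc d) m n eq
  with euclidsLemma m n prime[3] (subst (3 ∣_) (sym eq) (m∣m*n (3 ^ d)))
... | inj₁ 3∣m = inj₂ 3∣m
... | inj₂ (divides-refl q) = m*n≡3^d⇒m≡1⊎3∣m d m q (*-cancelˡ-≡ (m * q) (3 ^ d) 3 (begin
  3 * (m * q)  ≡⟨ rearrange m q ⟩
  m * (q * 3)  ≡⟨ eq ⟩
  3 * 3 ^ d    ∎))
  where
  open ≡-Reasoning
  rearrange : ∀ m q → 3 * (m * q) ≡ m * (q * 3)
  rearrange = solve-∀

m*[2+m]≡3^d⇒m≡1 : ∀ d m → m * (2 + m) ≡ 3 ^ d → m ≡ 1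
m*[2+m]≡3^d⇒m≡1 d m eq
  with m*n≡3^d⇒m≡1⊎3∣m d m (2 + m) eq | m*n≡3^d⇒m≡1⊎3∣m d (2 + m) m (trans (*-comm (2 + m) m) eq)
-- Both factors are tested. `2 + m` cannot be 1, so if 3 divides `m` it divides `2 + m` too, and
-- hence their difference 2.
... | inj₁ m≡1 | _          = m≡1
... | inj₂ 3∣m | inj₂ 3∣2+m = contradiction (∣m+n∣n⇒∣m 3∣2+m 3∣m) 3∤2

1+m*[2+m]≡[1+m]² : ∀ m → 1 + m * (2 + m) ≡ suc m * suc m
1+m*[2+m]≡[1+m]² = solve-∀

3^d≡3⇒d≡1 : ∀ d → 3 ^ d ≡ 3 → d ≡ 1
3^d≡3⇒d≡1 (suc d) eq with m^n≡1⇒n≡0∨m≡1 3 d (*-cancelˡ-≡ (3 ^ d) 1 3 eq)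
... | inj₁ refl = refl

1+3^d≡z²⇒ : ∀ d z → 1 + 3 ^ d ≡ z * z → d ≡ 1 × z ≡ 2
1+3^d≡z²⇒ d (suc m) eq
  with m*[2+m]≡3^d⇒m≡1 d m (suc-injective (trans (1+m*[2+m]≡[1+m]² m) (sym eq)))
... | refl = 3^d≡3⇒d≡1 d (suc-injective eq) , refl

3∤1+3^d : ∀ d → ¬ 3 ∣ 1 + 3 ^ d
3∤1+3^d zero    3∣sum = 3∤2 3∣sum
3∤1+3^d (suc d) 3∣sum = 3∤1 (∣m+n∣n⇒∣m 3∣sum (m∣m*n (3 ^ d)))

-- Since 3 is prime it divides `z`, so `z * z` carries 9. The factor 3 left over refutes exponent 1
-- and is cancelled in the descent from larger exponents.
3*m≡z²⇒m≡3*w² : ∀ m z → 3 * m ≡ z * z → ∃[ w ] z ≡ 3 * w × m ≡ 3 * (w * w)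
3*m≡z²⇒m≡3*w² m z eq with 3∣m*m⇒3∣m {z} (subst (3 ∣_) eq (m∣m*n m))
... | divides-refl w = w , *-comm w 3 , *-cancelˡ-≡ m _ 3 (trans eq (square w))
  where
  square : ∀ w → w * 3 * (w * 3) ≡ 3 * (3 * (w * w))
  square = solve-∀

-- Descent on `a` in steps of two. `d` never changes, so its value is settled where the descent
-- ends, at `a = 0`.
3^a*[1+3^d]≡z²⇒ : ∀ a d z → 3 ^ a * (1 + 3 ^ d) ≡ z * z →
                  ∃[ k ] a ≡ 2 * k × d ≡ 1 × z ≡ 2 * 3 ^ k
3^a*[1+3^d]≡z²⇒ zero d z eq
  with 1+3^d≡z²⇒ d z (trans (sym (*-identityˡ (1 + 3 ^ d))) eq)
... | d≡1 , z≡2 = 0 , refl , d≡1 , z≡2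
3^a*[1+3^d]≡z²⇒ (suc zero) d z eq with 3*m≡z²⇒m≡3*w² (1 + 3 ^ d) z eq
... | w , _ , eq′ = contradiction (subst (3 ∣_) (sym eq′) (m∣m*n (w * w))) (3∤1+3^d d)
3^a*[1+3^d]≡z²⇒ (suc (suc a)) d z eq
  with 3*m≡z²⇒m≡3*w² (3 * 3 ^ a * (1 + 3 ^ d)) z
         (trans (sym (*-assoc 3 (3 * 3 ^ a) (1 + 3 ^ d))) eq)
... | w , refl , eq′
  with 3^a*[1+3^d]≡z²⇒ a d w
         (*-cancelˡ-≡ (3 ^ a * (1 + 3 ^ d)) (w * w) 3
           (trans (sym (*-assoc 3 (3 ^ a) (1 + 3 ^ d))) eq′))
... | k , refl , d≡1 , refl = suc k , sym (*-suc 2 k) , d≡1 , swap (3 ^ k)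
  where
  swap : ∀ t → 3 * (2 * t) ≡ 2 * (3 * t)
  swap = solve-∀

3^a*[1+3^d]≡3^a+3^[a+d] : ∀ a d → 3 ^ a * (1 + 3 ^ d) ≡ 3 ^ a + 3 ^ (a + d)
3^a*[1+3^d]≡3^a+3^[a+d] a d =
  trans (*-suc (3 ^ a) (3 ^ d)) (cong (3 ^ a +_) (sym (^-distribˡ-+-* 3 a d)))

3^a+3^b≡z²⇒ : ∀ {a b} z → a ≤ b → 3 ^ a + 3 ^ b ≡ z ^ 2 →
              ∃[ k ] a ≡ 2 * k × b ≡ 1 + 2 * k × z ≡ 2 * 3 ^ k
3^a+3^b≡z²⇒ {a} z a≤b eq
  with d , refl ← m≤n⇒∃[o]m+o≡n a≤b
  with k , refl , refl , z≡2*3^k ← 3^a*[1+3^d]≡z²⇒ a d z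
         (trans (3^a*[1+3^d]≡3^a+3^[a+d] a d) (trans eq (cong (z *_) (*-identityʳ z))))
  = k , refl , +-comm (2 * k) 1 , z≡2*3^k

3*3^2k+3^2k≡[2*3^k]² : ∀ k → 3 * 3 ^ (2 * k) + 3 ^ (2 * k) ≡ (2 * 3 ^ k) ^ 2
3*3^2k+3^2k≡[2*3^k]² k = begin
  3 * 3 ^ (2 * k) + 3 ^ (2 * k)  ≡⟨ cong (λ t → 3 * t + t) 3^2k≡[3^k]² ⟩
  3 * (3 ^ k) ^ 2 + (3 ^ k) ^ 2  ≡⟨ collect (3 ^ k) ⟩
  (2 * 3 ^ k) ^ 2                ∎
  where
  open ≡-Reasoning
  3^2k≡[3^k]² : 3 ^ (2 * k) ≡ (3 ^ k) ^ 2
  3^2k≡[3^k]² = trans (cong (3 ^_) (*-comm 2 k)) (sym (^-*-assoc 3 k 2))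
  -- With `t` for `3 ^ k` this is 3t² + t² = (2t)², the squares written as `_^ 2` unfolds.
  collect : ∀ t → 3 * (t * (t * 1)) + t * (t * 1) ≡ 2 * t * (2 * t * 1)
  collect = solve-∀

theorem0p1 : (λ ((x , y , z) : ℕ × ℕ × ℕ) → 3 * 3 ^ x + 3 ^ y ≡ z ^ 2)
    ≐ ((λ t → ∃[ n ] t ≡ (2 * n , 2 * n , 2 * 3 ^ n))
    ∪ (λ t → ∃[ n ] t ≡ (1 + 2 * n , 3 + 2 * n , 2 * 3 ^ (n + 1))))
theorem0p1 = (λ {t} → solution⇒family t) , (λ {t} → family⇒solution t)
  where
  solution⇒family : ∀ ((x , y , z) : ℕ × ℕ × ℕ) → 3 * 3 ^ x + 3 ^ y ≡ z ^ 2 →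
    (∃[ n ] (x , y , z) ≡ (2 * n , 2 * n , 2 * 3 ^ n)) ⊎
    (∃[ n ] (x , y , z) ≡ (1 + 2 * n , 3 + 2 * n , 2 * 3 ^ (n + 1)))
  -- `3 * 3 ^ x` is `3 ^ suc x` by definition, so the symmetric lemma applies; the order of `suc x`
  -- and `y` selects the family.
  solution⇒family (x , y , z) eq with ≤-total (suc x) y
  ... | inj₂ y≤1+x
    with n , refl , refl , refl ← 3^a+3^b≡z²⇒ z y≤1+x (trans (+-comm (3 ^ y) (3 ^ suc x)) eq)
    = inj₁ (n , refl)
  ... | inj₁ 1+x≤y with 3^a+3^b≡z²⇒ z 1+x≤y eq
  -- Here the smaller exponent `suc x` equals `2 * k`, which excludes `k = 0`; hence the shift to
  -- `n + 1` in the second family.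
  ... | suc n , 1+x≡2+2n , refl , refl
    with refl ← suc-injective (trans 1+x≡2+2n (*-suc 2 n))
    = inj₂ (n , cong₂ (λ y k → 1 + 2 * n , y , 2 * 3 ^ k)
                      (cong suc (*-suc 2 n)) (+-comm 1 n))

  family⇒solution : ∀ ((x , y , z) : ℕ × ℕ × ℕ) →
    (∃[ n ] (x , y , z) ≡ (2 * n , 2 * n , 2 * 3 ^ n)) ⊎
    (∃[ n ] (x , y , z) ≡ (1 + 2 * n , 3 + 2 * n , 2 * 3 ^ (n + 1))) →
    3 * 3 ^ x + 3 ^ y ≡ z ^ 2
  family⇒solution _ (inj₁ (n , refl)) = 3*3^2k+3^2k≡[2*3^k]² n
  family⇒solution _ (inj₂ (n , refl)) = begin
    -- In this family the second summand is the larger one; swapping the two gives the identity used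
    -- for the first family, at `k = n + 1`.
    3 ^ (2 + 2 * n) + 3 ^ (3 + 2 * n)              ≡⟨ +-comm (3 ^ (2 + 2 * n)) _ ⟩
    3 * 3 ^ (2 + 2 * n) + 3 ^ (2 + 2 * n)          ≡⟨ cong (λ e → 3 * 3 ^ e + 3 ^ e) 2+2n≡2[n+1] ⟩
    3 * 3 ^ (2 * (n + 1)) + 3 ^ (2 * (n + 1))      ≡⟨ 3*3^2k+3^2k≡[2*3^k]² (n + 1) ⟩
    (2 * 3 ^ (n + 1)) ^ 2                          ∎
    where
    open ≡-Reasoning
    2+2n≡2[n+1] : 2 + 2 * n ≡ 2 * (n + 1)
    2+2n≡2[n+1] = trans (sym (*-suc 2 n)) (cong (2 *_) (+-comm 1 n))
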